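{- Let $k \ge 3$ be an integer and let $G^O(k) = (C \cup (V\setminus C), E)$ be any graph with vertex set $V$ and $C\subseteq V$ such that $|C|=k$, the induced subgraph $G^O(k)[C]$ has no open twins, and $V\setminus C$ consists of exactly one vertex $v_{C'}$ with $N(v_{C'})\cap C=C'$ for each non-empty subset $C'\subseteq C$ such that there is no vertex $u\in C$ with $N(u)\cap C=C'$ (with no condition on the edges inside $V\setminus C$). Then in $G^O(k)$, the set $C$ is a minimum-cardinality (i) OD-code; (ii) OTD-code if $G^O(k)[C]$ has no isolated vertex, that is, if $G^O(k)[C]$ is OTD-admissible. Moreover, for $X \in \{\mathrm{OD}, \mathrm{OTD}\}$, the minimum X-density among all X-admissible graphs with X-number $k$ is attained by the graphs $G^O(k)$ for which $G^O(k)[C]$ has an isolated vertex if $X=\mathrm{OD}$, and by those graphs $G^O(k)$ for which $G^O(k)[C]$ has no isolated vertex if $X=\mathrm{OTD}$.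
   Context: Graphs are finite, simple and undirected. For a graph $G=(V,E)$ and $v\in V$, $N(v)$ is the open neighborhood and $N[v]=N(v)\cup\{v\}$ the closed neighborhood; $G[C]$ is the subgraph induced by $C$. Open twins are distinct non-adjacent vertices $u,v$ with $N(u)=N(v)$. A set $C\subseteq V$ is dominating (resp. total-dominating) if $N[v]\cap C\neq\emptyset$ (resp. $N(v)\cap C\ne\emptyset$) for all $v\in V$. A set $C$ is open-separating if $N(u)\cap C\neq N(v)\cap C$ for all distinct $u,v\in V$ (the set $N(v)\cap C$ may be empty for at most one vertex). An OD-code (resp. OTD-code) is a set that is open-separating and dominating (resp. total-dominating). A graph is X-admissible if it has an X-code; the X-number $\gamma^{X}(G)$ of an X-admissible graph is the minimum cardinality of an X-code of $G$. The X-density of an X-admissible graph $G$ on $n$ vertices is $\gamma^{X}(G)/n$. -}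

module Defs where

open import Data.Bool.Base using (Bool; true; false; T)
open import Data.Fin.Base using (Fin; zero; suc)
open import Data.Fin.Properties using (suc-injective)
open import Data.Fin.Subset
  using (Subset; _∈_; _∉_; _⊆_; _∩_; _∪_; ⁅_⁆; ∣_∣; Nonempty; Empty)
open import Data.Integer.Base using (+_)
open import Data.Nat.Base as ℕ using (ℕ; NonZero)
open import Data.Nat.Properties using (≤-antisym)
open import Data.Product.Base using (Σ-syntax; ∃-syntax; _×_; _,_)
open import Data.Product using (∃!)
open import Data.Rational.Base using (ℚ; _/_; _≤_)
open import Data.Vec.Base using ([]; _∷_; tabulate; here; there)
open import Relation.Binary.PropositionalEquality
  using (_≡_; _≢_; refl; cong)
open import Relation.Nullary.Negation using (¬_)

-- Finite simple undirected graphs with vertex set Fin n.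
record Graph (n : ℕ) : Set where
  field
    adj        : Fin n → Fin n → Bool
    adj-sym    : ∀ u v → adj u v ≡ adj v u
    adj-irrefl : ∀ v → adj v v ≡ false

  Adjacent : Fin n → Fin n → Set
  Adjacent u v = T (adj u v)

  N : Fin n → Subset n
  N v = tabulate (adj v)

  N[_] : Fin n → Subset n
  N[ v ] = N v ∪ ⁅ v ⁆

-- The increasing enumeration of the elements of a subset.
enum : ∀ {n} (C : Subset n) → Fin ∣ C ∣ → Fin n
enum (true  ∷ C) zero    = zero
enum (true  ∷ C) (suc i) = suc (enum C i)
enum (false ∷ C) i       = suc (enum C i)

enum-∈ : ∀ {n} (C : Subset n) i → enum C i ∈ C
enum-∈ (true  ∷ C) zero    = here
enum-∈ (true  ∷ C) (suc i) = there (enum-∈ C i)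
enum-∈ (false ∷ C) i       = there (enum-∈ C i)

enum-injective : ∀ {n} (C : Subset n) {i j} → enum C i ≡ enum C j → i ≡ j
enum-injective (true  ∷ C) {zero}  {zero}  _  = refl
enum-injective (true  ∷ C) {suc i} {suc j} eq =
  cong suc (enum-injective C (suc-injective eq))
enum-injective (false ∷ C) eq = enum-injective C (suc-injective eq)

enum-surjective : ∀ {n} (C : Subset n) {v} → v ∈ C → ∃[ i ] enum C i ≡ v
enum-surjective (true ∷ C) here = zero , refl
enum-surjective (true ∷ C) (there v∈C) with enum-surjective C v∈C
... | i , eq = suc i , cong suc eq
enum-surjective (false ∷ C) (there v∈C) with enum-surjective C v∈C
... | i , eq = i , cong suc eq

-- The induced subgraph G[C], with the elements of C renumbered by enum C.
induced : ∀ {n} → Graph n → (C : Subset n) → Graph ∣ C ∣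
induced G C = record
  { adj        = λ i j → adj (enum C i) (enum C j)
  ; adj-sym    = λ i j → adj-sym (enum C i) (enum C j)
  ; adj-irrefl = λ i → adj-irrefl (enum C i)
  }
  where open Graph G

module _ {n : ℕ} (G : Graph n) where
  open Graph G

  OpenTwins : Fin n → Fin n → Set
  OpenTwins u v = u ≢ v × ¬ Adjacent u v × N u ≡ N v

  HasOpenTwins : Set
  HasOpenTwins = ∃[ u ] ∃[ v ] OpenTwins u v

  Isolated : Fin n → Set
  Isolated v = Empty (N v)

  HasIsolatedVertex : Set
  HasIsolatedVertex = ∃[ v ] Isolated v

  Dominating : Subset n → Set
  Dominating C = ∀ v → Nonempty (N[ v ] ∩ C)

  TotalDominating : Subset n → Set
  TotalDominating C = ∀ v → Nonempty (N v ∩ C)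

  OpenSeparating : Subset n → Set
  OpenSeparating C = ∀ u v → u ≢ v → N u ∩ C ≢ N v ∩ C

data CodeType : Set where
  OD OTD : CodeType

IsCode : CodeType → ∀ {n} → Graph n → Subset n → Set
IsCode OD  G C = OpenSeparating G C × Dominating G C
IsCode OTD G C = OpenSeparating G C × TotalDominating G C

module _ (X : CodeType) {n : ℕ} (G : Graph n) where

  Admissible : Set
  Admissible = ∃[ C ] IsCode X G C

  IsMinimumCode : Subset n → Set
  IsMinimumCode C = IsCode X G C × (∀ D → IsCode X G D → ∣ C ∣ ℕ.≤ ∣ D ∣)

  -- γ is the X-number of G.  The X-number is partial, hence a relation.
  IsNumber : ℕ → Set
  IsNumber γ = ∃[ C ] IsMinimumCode C × ∣ C ∣ ≡ γ

  -- q is the X-density of G; the graph without vertices has no density.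
  IsDensity : ℚ → Set
  IsDensity q = Σ[ n≢0 ∈ NonZero n ] ∃[ γ ]
    IsNumber γ × q ≡ _/_ (+ γ) n {{n≢0}}

  IsNumber-unique : ∀ {γ γ′} → IsNumber γ → IsNumber γ′ → γ ≡ γ′
  IsNumber-unique (C , (codeC , minC) , refl) (D , (codeD , minD) , refl) =
    ≤-antisym (minC D codeD) (minD C codeC)

-- q is the X-density of some X-admissible graph with X-number k.
DensityAtNumber : CodeType → ℕ → ℚ → Set
DensityAtNumber X k q = ∃[ n ] Σ[ H ∈ Graph n ]
  Admissible X H × IsNumber X H k × IsDensity X H q

IsMinimumDensity : CodeType → ℕ → ℚ → Set
IsMinimumDensity X k q =
  DensityAtNumber X k q × (∀ r → DensityAtNumber X k r → q ≤ r)

-- G belongs to the class over which the minimum is taken, and its density is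
-- that minimum.
AttainsMinimumDensity : CodeType → ℕ → ∀ {n} → Graph n → Set
AttainsMinimumDensity X k G =
  Admissible X G × IsNumber X G k ×
  (∃[ q ] IsDensity X G q × IsMinimumDensity X k q)

-- G together with C is a graph G^O(k).
record IsGO (k : ℕ) {n : ℕ} (G : Graph n) (C : Subset n) : Set where
  open Graph G

  -- The non-empty subsets of C that are not the trace on C of the
  -- neighbourhood of a vertex of C.
  Missing : Subset n → Set
  Missing C′ = Nonempty C′ × C′ ⊆ C × ¬ (∃[ u ] u ∈ C × N u ∩ C ≡ C′)

  field
    card     : ∣ C ∣ ≡ k
    no-twins : ¬ HasOpenTwins (induced G C)
    -- These two fields say that v ↦ N v ∩ C is a bijection from V ∖ C to the
    -- missing subsets; edges inside V ∖ C are unconstrained.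
    outside  : ∀ v → v ∉ C → Missing (N v ∩ C)
    missing  : ∀ C′ → Missing C′ → ∃! _≡_ (λ v → v ∉ C × N v ∩ C ≡ C′)

{-# OPTIONS --safe #-}
-- An open-separating set D makes v ↦ N v ∩ D injective, so a graph with such a
-- set has at most 2 ^ ∣ D ∣ vertices, and one fewer if no trace is empty, as
-- for OTD-codes.  In G^O(k) every non-empty subset of C is the trace of exactly
-- one vertex, and the empty one is a trace exactly if G[C] has an isolated
-- vertex: the bounds are met, and 2 ^ k ∸ 1 vertices are too many for an
-- open-separating set with fewer than k ≥ 3 elements.
-- A graph G^O(k) is obtained from any twin-free graph on k vertices by attaching
-- one vertex for each missing subset.
module Submission where

open import Data.Bool.Base using (Bool; true; false; T; not; _∧_)
open import Data.Bool.Properties as Bool using (∧-identityʳ; ∧-zeroʳ)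
open import Data.Empty using (⊥-elim)
open import Data.Fin.Base using (Fin; zero; suc; _↑ˡ_; _↑ʳ_; splitAt)
open import Data.Fin.Properties
  using (_≟_; any?; injective⇒≤; suc-injective; *↔×; 2↔Bool;
         splitAt-↑ˡ; splitAt-↑ʳ; join-splitAt)
open import Data.Fin.Subset
  using (Subset; _∈_; _∉_; _⊆_; _∩_; ∣_∣; Nonempty; Empty; ⊤; ⊥)
open import Data.Fin.Subset.Properties
  using (_∈?_; nonempty?; Empty-unique; ∉⊥; ∈⊤; ∣⊥∣≡0; ∣p∣≤n; ⊆-antisym;
         ⊆-min; drop-∷-⊆; x∈p∩q⁺; x∈p∩q⁻; p∩q⊆p; p∩q⊆q; x∈p∪q⁺; x∈⁅x⁆)
open import Data.Integer.Base using (+_; +≤+)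
import Data.Integer.Properties as ℤ
open import Data.Nat.Base
  using (ℕ; zero; suc; _+_; _^_; _≤_; _<_; z≤n; s≤s; s≤s⁻¹; NonZero; >-nonZero)
open import Data.Nat.Properties
  using (≤-trans; ≰⇒>; <⇒≱; _≤?_; ^-monoʳ-≤; +-identityʳ;
         +-cancelʳ-≤; module ≤-Reasoning)
open import Data.Product.Base using (Σ-syntax; ∃-syntax; _×_; _,_; proj₁; proj₂; uncurry)
open import Data.Product.Function.NonDependent.Propositional using (_×-↔_)
open import Data.Rational.Base using (_/_; toℚᵘ) renaming (_≤_ to _≤ℚ_)
open import Data.Rational.Properties using (toℚᵘ-cancel-≤; toℚᵘ-fromℚᵘ)
open import Data.Rational.Unnormalised.Base using (mkℚᵘ; *≤*)
import Data.Rational.Unnormalised.Properties as ℚᵘ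
open import Data.Sum.Base using (_⊎_; inj₁; inj₂; [_,_]′)
open import Data.Vec.Base using ([]; _∷_; _++_; here; there; lookup; tabulate; uncons)
open import Data.Vec.Properties
  using (≡-dec; lookup∘tabulate; tabulate∘lookup; tabulate-cong; lookup-splitAt;
         lookup-replicate; lookup-zipWith; ++-injectiveˡ; []=⇒lookup; lookup⇒[]=)
open import Function.Base using (_∘_)
open import Function.Bundles using (_⇔_; mk⇔; _↔_; mk↔ₛ′; Inverse)
open import Function.Construct.Composition using (_↔-∘_)
open import Function.Construct.Symmetry using (↔-sym)
open import Function.Definitions using (Injective)
open import Level using (0ℓ)
open import Relation.Binary.Definitions using (DecidableEquality)
open import Relation.Binary.PropositionalEquality
  using (_≡_; _≢_; refl; sym; trans; cong; cong₂; subst; module ≡-Reasoning)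
open import Relation.Nullary.Decidable
  using (yes; no; does; ¬?; _×-dec_; decidable-stable; dec-true)
open import Relation.Nullary.Negation using (¬_; contradiction)
open import Relation.Unary using (Pred; Decidable)
open import Defs

private variable
  k m n : ℕ

-- Subsets

-- Binary encoding of subsets. It turns maps between vertices and subsets into maps between `Fin`
-- types, where an injection bounds cardinalities.
Subset↔Fin : ∀ n → Subset n ↔ Fin (2 ^ n)
Subset↔Fin zero    = mk↔ₛ′ (λ _ → zero) (λ _ → []) (λ { zero → refl }) (λ { [] → refl })
Subset↔Fin (suc n) =
  ↔-sym *↔× ↔-∘ ((↔-sym 2↔Bool ×-↔ Subset↔Fin n)
    ↔-∘ mk↔ₛ′ uncons (uncurry _∷_) (λ _ → refl) (λ { (_ ∷ _) → refl }))

module _ {n : ℕ} where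
  open Inverse (Subset↔Fin n) public
    using () renaming (to to encode; from to decode;
                       strictlyInverseˡ to encode-decode; strictlyInverseʳ to decode-encode)

  encode-injective : Injective _≡_ _≡_ encode
  encode-injective {S} {S′} eq =
    trans (sym (decode-encode S)) (trans (cong decode eq) (decode-encode S′))

  decode-injective : Injective _≡_ _≡_ decode
  decode-injective {i} {j} eq =
    trans (sym (encode-decode i)) (trans (cong encode eq) (encode-decode j))

_≟ₛ_ : DecidableEquality (Subset n)
_≟ₛ_ = ≡-dec Bool._≟_

-- A list of the subsets satisfying `P`, without repetition. It serves to index the vertices
-- attached to a base graph by its missing subsets.
record Enumeration (P : Pred (Subset k) 0ℓ) : Set where
  field
    {size}    : ℕ
    member    : Fin size → Subset k
    injective : Injective _≡_ _≡_ member
    sound     : ∀ i → P (member i)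
    complete  : ∀ {S} → P S → ∃[ i ] member i ≡ S

-- The codes of the subsets satisfying `P` form a subset of `Fin (2 ^ k)`, which `enum` lists
-- without repetition.
enumerate : {P : Pred (Subset k) 0ℓ} → Decidable P → Enumeration P
enumerate {k} {P} P? = record
  { member    = λ i → decode (enum codes i)
  ; injective = λ eq → enum-injective codes (decode-injective eq)
  ; sound     = λ i → sound (enum-∈ codes i)
  ; complete  = complete
  }
  where
  codes : Subset (2 ^ k)
  codes = tabulate (λ c → does (P? (decode c)))

  sound : ∀ {c} → c ∈ codes → P (decode c)
  sound {c} c∈ with P? (decode c) | trans (sym (lookup∘tabulate _ c)) ([]=⇒lookup c∈)
  ... | yes p | _ = p

  complete : ∀ {S} → P S → ∃[ i ] decode (enum codes i) ≡ S
  complete {S} p with enum-surjective codes {encode S} (lookup⇒[]= _ codes (begin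
      lookup codes (encode S)       ≡⟨ lookup∘tabulate _ (encode S) ⟩
      does (P? (decode (encode S))) ≡⟨ cong (does ∘ P?) (decode-encode S) ⟩
      does (P? S)                   ≡⟨ dec-true (P? S) p ⟩
      true                          ∎))
    where open ≡-Reasoning
  ... | i , eq = i , trans (cong decode eq) (decode-encode S)

-- The image of a subset of `Fin ∣ C ∣` under `enum C`; it undoes the renumbering of the elements of
-- `C`.
extend : (C : Subset n) → Subset ∣ C ∣ → Subset n
extend []          []      = []
extend (true  ∷ C) (s ∷ S) = s ∷ extend C S
extend (false ∷ C) S       = false ∷ extend C S

extend-injective : (C : Subset n) → Injective _≡_ _≡_ (extend C)
extend-injective []          {[]}    {[]}     _  = refl
extend-injective (true  ∷ C) {_ ∷ _} {_ ∷ _} eq =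
  cong₂ _∷_ (cong (λ S → lookup S zero) eq) (extend-injective C (cong (proj₂ ∘ uncons) eq))
extend-injective (false ∷ C) eq = extend-injective C (cong (proj₂ ∘ uncons) eq)

extend-tabulate : (C : Subset n) (f : Fin n → Bool) →
  extend C (tabulate (f ∘ enum C)) ≡ tabulate f ∩ C
extend-tabulate []          f = refl
extend-tabulate (true  ∷ C) f =
  cong₂ _∷_ (sym (∧-identityʳ (f zero))) (extend-tabulate C (f ∘ suc))
extend-tabulate (false ∷ C) f =
  cong₂ _∷_ (sym (∧-zeroʳ (f zero))) (extend-tabulate C (f ∘ suc))

extend-⊆ : (C : Subset n) (S : Subset ∣ C ∣) → extend C S ⊆ C
extend-⊆ (true  ∷ C) (_ ∷ S) here       = here
extend-⊆ (true  ∷ C) (_ ∷ S) (there v∈) = there (extend-⊆ C S v∈)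
extend-⊆ (false ∷ C) S       (there v∈) = there (extend-⊆ C S v∈)

extend-nonempty⁺ : (C : Subset n) {S : Subset ∣ C ∣} → Nonempty S → Nonempty (extend C S)
extend-nonempty⁺ C (i , i∈) = enum C i , go C i∈
  where
  go : (C : Subset n) {S : Subset ∣ C ∣} {i : Fin ∣ C ∣} → i ∈ S → enum C i ∈ extend C S
  go (true  ∷ C) here       = here
  go (true  ∷ C) (there i∈) = there (go C i∈)
  go (false ∷ C) i∈         = there (go C i∈)

extend-nonempty⁻ : (C : Subset n) {S : Subset ∣ C ∣} → Nonempty (extend C S) → Nonempty S
extend-nonempty⁻ C (_ , v∈) = go C v∈
  where
  go : (C : Subset n) {S : Subset ∣ C ∣} {v : Fin n} → v ∈ extend C S → Nonempty S
  go (true  ∷ C) {_ ∷ _} here       = zero , here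
  go (true  ∷ C) {_ ∷ _} (there v∈) with go C v∈
  ... | i , i∈ = suc i , there i∈
  go (false ∷ C) (there v∈) = go C v∈

-- Subsets padded by the empty set

∈-++⁺ˡ : {S : Subset k} {S′ : Subset m} {i : Fin k} → i ∈ S → i ↑ˡ m ∈ S ++ S′
∈-++⁺ˡ here       = here
∈-++⁺ˡ (there i∈) = there (∈-++⁺ˡ i∈)

∈-++⊥⁻ : (S : Subset k) {v : Fin (k + m)} → v ∈ S ++ ⊥ → ∃[ i ] i ∈ S × i ↑ˡ m ≡ v
∈-++⊥⁻ []      v∈         = ⊥-elim (∉⊥ v∈)
∈-++⊥⁻ (_ ∷ S) here       = zero , here , refl
∈-++⊥⁻ (_ ∷ S) (there v∈) with ∈-++⊥⁻ S v∈
... | i , i∈ , refl = suc i , there i∈ , refl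

⊆⊤++⊥⁻ : ∀ k (S : Subset (k + m)) → S ⊆ ⊤ {k} ++ ⊥ → Σ[ S′ ∈ Subset k ] S ≡ S′ ++ ⊥
⊆⊤++⊥⁻ zero    S       S⊆ = [] , ⊆-antisym S⊆ (⊆-min S)
⊆⊤++⊥⁻ (suc k) (s ∷ S) S⊆ with ⊆⊤++⊥⁻ k S (drop-∷-⊆ S⊆)
... | S′ , refl = s ∷ S′ , refl

∣⊤++⊥∣≡ : ∀ k m → ∣ ⊤ {k} ++ ⊥ {m} ∣ ≡ k
∣⊤++⊥∣≡ zero    m = ∣⊥∣≡0 m
∣⊤++⊥∣≡ (suc k) m = cong suc (∣⊤++⊥∣≡ k m)

-- Traces

module _ (G : Graph n) where
  open Graph G

  adj≡lookup : ∀ u v → lookup (N u) v ≡ adj u v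
  adj≡lookup u v = lookup∘tabulate (adj u) v

  -- Equal neighbourhoods already force non-adjacency: `v` in `N u = N v` would be a loop. Hence
  -- distinct vertices with equal neighbourhoods are open twins.
  N-injective : ¬ HasOpenTwins G → Injective _≡_ _≡_ N
  N-injective ¬twins {u} {v} eq with u ≟ v
  ... | yes u≡v = u≡v
  ... | no  u≢v = contradiction (u , v , u≢v , subst T non-adjacent , eq) ¬twins
    where
    open ≡-Reasoning
    non-adjacent : adj u v ≡ false
    non-adjacent = begin
      adj u v        ≡⟨ adj≡lookup u v ⟨
      lookup (N u) v ≡⟨ cong (λ S → lookup S v) eq ⟩
      lookup (N v) v ≡⟨ adj≡lookup v v ⟩
      adj v v        ≡⟨ adj-irrefl v ⟩
      false          ∎

  -- The trace N v ∩ C with the elements of C renumbered by enum C, so that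
  -- trace C (enum C i) is the neighbourhood of i in induced G C.
  trace : (C : Subset n) → Fin n → Subset ∣ C ∣
  trace C v = tabulate (adj v ∘ enum C)

  extend-trace : ∀ C v → extend C (trace C v) ≡ N v ∩ C
  extend-trace C v = extend-tabulate C (adj v)

  trace≡⇒N∩≡ : ∀ C {u v} → trace C u ≡ trace C v → N u ∩ C ≡ N v ∩ C
  trace≡⇒N∩≡ C {u} {v} eq =
    trans (sym (extend-trace C u)) (trans (cong (extend C) eq) (extend-trace C v))

  N∩≡⇒trace≡ : ∀ C {u v} → N u ∩ C ≡ N v ∩ C → trace C u ≡ trace C v
  N∩≡⇒trace≡ C {u} {v} eq =
    extend-injective C (trans (extend-trace C u) (trans eq (sym (extend-trace C v))))

  trace-nonempty⁺ : ∀ C {v} → Nonempty (N v ∩ C) → Nonempty (trace C v)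
  trace-nonempty⁺ C {v} = extend-nonempty⁻ C ∘ subst Nonempty (sym (extend-trace C v))

  trace-nonempty⁻ : ∀ C {v} → Nonempty (trace C v) → Nonempty (N v ∩ C)
  trace-nonempty⁻ C {v} = subst Nonempty (extend-trace C v) ∘ extend-nonempty⁺ C

  separating⇒trace-injective : ∀ {D} → OpenSeparating G D → Injective _≡_ _≡_ (trace D)
  separating⇒trace-injective {D} sep {u} {v} eq =
    decidable-stable (u ≟ v) (λ u≢v → sep u v u≢v (trace≡⇒N∩≡ D eq))

  -- The `n` vertices have distinct traces, and there are `2 ^ ∣ D ∣` possible ones.
  separating⇒n≤2^ : ∀ {D} → OpenSeparating G D → n ≤ 2 ^ ∣ D ∣
  separating⇒n≤2^ sep =
    injective⇒≤ (separating⇒trace-injective sep ∘ encode-injective)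

  totalDominating⇒n<2^ : ∀ {D} → OpenSeparating G D → TotalDominating G D → n < 2 ^ ∣ D ∣
  totalDominating⇒n<2^ {D} sep dom = injective⇒≤ (f-injective ∘ encode-injective)
    where
    -- The additional argument `zero` takes the empty subset, which total domination excludes as a
    -- trace; this makes the bound strict.
    f : Fin (suc n) → Subset ∣ D ∣
    f zero    = ⊥
    f (suc v) = trace D v

    ⊥≢trace : ∀ v → ⊥ ≢ trace D v
    ⊥≢trace v eq with subst Nonempty (sym eq) (trace-nonempty⁺ D (dom v))
    ... | _ , i∈ = ∉⊥ i∈

    f-injective : Injective _≡_ _≡_ f
    f-injective {zero}  {zero}  _  = refl
    f-injective {zero}  {suc v} eq = contradiction eq (⊥≢trace v)
    f-injective {suc u} {zero}  eq = contradiction (sym eq) (⊥≢trace u)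
    f-injective {suc u} {suc v} eq = cong suc (separating⇒trace-injective sep eq)

noIsolated⇒totalDominating : (G : Graph n) → ¬ HasIsolatedVertex G → TotalDominating G ⊤
noIsolated⇒totalDominating G ¬iso v with nonempty? (Graph.N G v)
... | yes (w , w∈) = w , x∈p∩q⁺ (w∈ , ∈⊤)
... | no  empty    = contradiction (v , empty) ¬iso

twinFree⇒separating : (G : Graph n) → ¬ HasOpenTwins G → OpenSeparating G ⊤
twinFree⇒separating G ¬twins u v u≢v eq = u≢v (N-injective G ¬twins (begin
  N u     ≡⟨ ∩⊤ (N u) ⟨
  N u ∩ ⊤ ≡⟨ eq ⟩
  N v ∩ ⊤ ≡⟨ ∩⊤ (N v) ⟩
  N v     ∎))
  where
  open ≡-Reasoning
  open Graph G
  ∩⊤ : ∀ {n} (S : Subset n) → S ∩ ⊤ ≡ S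
  ∩⊤ S = ⊆-antisym (p∩q⊆p S ⊤) (λ x∈ → x∈p∩q⁺ (x∈ , ∈⊤))

-- Without isolated vertices the whole vertex set is an OTD-code; conversely, total domination gives
-- every vertex a neighbour.
otd-admissible : (G : Graph n) → ¬ HasOpenTwins G →
  (¬ HasIsolatedVertex G) ⇔ Admissible OTD G
otd-admissible G ¬twins = mk⇔
  (λ ¬iso → ⊤ , twinFree⇒separating G ¬twins , noIsolated⇒totalDominating G ¬iso)
  (λ (D , _ , dom) (v , empty) → let w , w∈ = dom v in
    empty (w , p∩q⊆p (Graph.N G v) D w∈))

-- Densities

-- `_/_` reduces to lowest terms, so the comparison passes to unnormalised fractions, where it is
-- cross-multiplication.
/-antimonoʳ-≤ : ∀ a {m n} (m≢0 : NonZero m) (n≢0 : NonZero n) → m ≤ n →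
  _/_ (+ a) n {{n≢0}} ≤ℚ _/_ (+ a) m {{m≢0}}
/-antimonoʳ-≤ a {suc m} {suc n} _ _ m≤n = toℚᵘ-cancel-≤ (begin
  toℚᵘ (+ a / suc n) ≃⟨ toℚᵘ-fromℚᵘ (mkℚᵘ (+ a) n) ⟩
  mkℚᵘ (+ a) n       ≤⟨ *≤* (ℤ.*-monoˡ-≤-nonNeg (+ a) (+≤+ m≤n)) ⟩
  mkℚᵘ (+ a) m       ≃⟨ toℚᵘ-fromℚᵘ (mkℚᵘ (+ a) m) ⟨
  toℚᵘ (+ a / suc m) ∎)
  where open ℚᵘ.≤-Reasoning

-- Among graphs with X-number `k` the numerator of the density is fixed, so a graph with the most
-- vertices has the least density.
mostVertices⇒minimumDensity : ∀ X {k n} (G : Graph n) {C} → NonZero n →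
  IsMinimumCode X G C → ∣ C ∣ ≡ k →
  (∀ {m} (H : Graph m) {D} → IsCode X H D → ∣ D ∣ ≡ k → m ≤ n) →
  AttainsMinimumDensity X k G
mostVertices⇒minimumDensity X {k} {n} G {C} n≢0 min@(code , _) card bound =
  (C , code) , number , q , density ,
  ((n , G , (C , code) , number , density) , minimal)
  where
  number : IsNumber X G k
  number = C , min , card

  q = _/_ (+ k) n {{n≢0}}

  density : IsDensity X G q
  density = n≢0 , k , number , refl

  minimal : ∀ r → DensityAtNumber X k r → q ≤ℚ r
  minimal _ (m , H , _ , number′@(D , (codeD , _) , cardD) , m≢0 , γ , numberγ , refl)
    -- The density of `H` comes with its own X-number `γ`; uniqueness identifies it with `k`, so
    -- both fractions have the same numerator.
    with refl ← IsNumber-unique X H number′ numberγ =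
    /-antimonoʳ-≤ k m≢0 n≢0 (bound H codeD cardD)

-- The graphs G^O(k)

-- Otherwise `d` is at most the predecessor of `k`; cancelling half of the left-hand power leaves a
-- power of two with exponent at least 2 that is at most 1. This is where `3 ≤ k` enters.
2^k≤1+2^d⇒k≤d : ∀ {k d} → 3 ≤ k → 2 ^ k ≤ suc (2 ^ d) → k ≤ d
2^k≤1+2^d⇒k≤d {suc k} {d} (s≤s 2≤k) le with suc k ≤? d
... | yes k<d = k<d
... | no  k≮d = contradiction (+-cancelʳ-≤ (2 ^ k) (2 ^ k) 1 (begin
  2 ^ k + 2 ^ k ≡⟨ cong (λ x → 2 ^ k + x) (+-identityʳ (2 ^ k)) ⟨
  2 ^ suc k     ≤⟨ le ⟩
  suc (2 ^ d)   ≤⟨ s≤s (^-monoʳ-≤ 2 (s≤s⁻¹ (≰⇒> k≮d))) ⟩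
  suc (2 ^ k)   ∎)) (<⇒≱ (≤-trans (s≤s (s≤s z≤n)) (^-monoʳ-≤ 2 2≤k)))
  where open ≤-Reasoning

module Codes {k : ℕ} (3≤k : 3 ≤ k) {G : Graph n} {C : Subset n} (go : IsGO k G C) where
  open Graph G
  open IsGO go

  -- Two vertices of `C` are told apart because `G[C]` has no twins, a vertex inside from one
  -- outside because the outer trace is missing inside, and two outer vertices by the uniqueness in
  -- `missing`.
  trace-injective : Injective _≡_ _≡_ (trace G C)
  trace-injective {u} {v} eq with u ∈? C | v ∈? C | trace≡⇒N∩≡ G C {u} {v} eq
  ... | yes u∈ | yes v∈ | _
    with i , refl ← enum-surjective C u∈ | j , refl ← enum-surjective C v∈ =
    cong (enum C) (N-injective (induced G C) no-twins eq)
  ... | yes u∈ | no  v∉ | eq′ =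
    contradiction (u , u∈ , eq′) (proj₂ (proj₂ (outside v v∉)))
  ... | no  u∉ | yes v∈ | eq′ =
    contradiction (v , v∈ , sym eq′) (proj₂ (proj₂ (outside u u∉)))
  ... | no  u∉ | no  v∉ | eq′ with missing (N v ∩ C) (outside v v∉)
  ... | _ , _ , unique = trans (sym (unique (u∉ , eq′))) (unique (v∉ , refl))

  -- A non-empty subset of `C` is the trace of a vertex of `C` or else is missing, and then an outer
  -- vertex realises it.
  trace-surjective : ∀ {S} → Nonempty S → ∃[ v ] trace G C v ≡ S
  trace-surjective {S} S≢∅ = let v , eq = vertex in
    v , extend-injective C (trans (extend-trace G C v) eq)
    where
    vertex : ∃[ v ] N v ∩ C ≡ extend C S
    vertex with any? (λ u → (u ∈? C) ×-dec ((N u ∩ C) ≟ₛ extend C S))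
    ... | yes (u , _ , eq) = u , eq
    ... | no  ∄u with missing (extend C S) (extend-nonempty⁺ C S≢∅ , extend-⊆ C S , ∄u)
    ... | v , (_ , eq) , _ = v , eq

  2^k≤1+n : 2 ^ k ≤ suc n
  2^k≤1+n = subst (λ c → 2 ^ c ≤ suc n) card
    (injective⇒≤ {f = f ∘ decode} (decode-injective ∘ f-injective))
    where
    -- The empty subset may fail to be a trace, so it goes to the spare value `zero`, and vertices
    -- are shifted by `suc`.
    f : Subset ∣ C ∣ → Fin (suc n)
    f S with nonempty? S
    ... | yes S≢∅ = suc (proj₁ (trace-surjective S≢∅))
    ... | no  _   = zero

    f-injective : Injective _≡_ _≡_ f
    f-injective {S} {S′} eq with nonempty? S | nonempty? S′
    ... | yes S≢∅ | yes S′≢∅ =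
      trans (sym (proj₂ (trace-surjective S≢∅)))
        (trans (cong (trace G C) (suc-injective eq)) (proj₂ (trace-surjective S′≢∅)))
    ... | no  S≡∅ | no  S′≡∅ = trans (Empty-unique S≡∅) (sym (Empty-unique S′≡∅))

  -- An isolated vertex of `G[C]` has empty trace, so every subset of `C` is a trace.
  2^k≤n : HasIsolatedVertex (induced G C) → 2 ^ k ≤ n
  2^k≤n (i , empty) = subst (λ c → 2 ^ c ≤ n) card
    (injective⇒≤ {f = proj₁ ∘ preimage ∘ decode} λ {c} {d} eq →
      decode-injective (trans (sym (proj₂ (preimage (decode c))))
        (trans (cong (trace G C) eq) (proj₂ (preimage (decode d))))))
    where
    preimage : ∀ S → ∃[ v ] trace G C v ≡ S
    preimage S with nonempty? S
    ... | yes S≢∅ = trace-surjective S≢∅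
    ... | no  S≡∅ = enum C i , trans (Empty-unique empty) (sym (Empty-unique S≡∅))

  -- With `d = ∣ D ∣`, the two counts give `2 ^ k ≤ 1 + n ≤ 1 + 2 ^ d`. Both kinds of code are
  -- open-separating, so this settles minimality for OD and OTD alike.
  separating-minimum : ∀ {D} → OpenSeparating G D → ∣ C ∣ ≤ ∣ D ∣
  separating-minimum sep rewrite card =
    2^k≤1+2^d⇒k≤d 3≤k (≤-trans 2^k≤1+n (s≤s (separating⇒n≤2^ G sep)))

  separating : OpenSeparating G C
  separating u v u≢v eq = u≢v (trace-injective (N∩≡⇒trace≡ G C eq))

  dominating : Dominating G C
  dominating v with v ∈? C
  ... | yes v∈ = v , x∈p∩q⁺ (x∈p∪q⁺ (inj₂ (x∈⁅x⁆ v)) , v∈)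
  ... | no  v∉ = let w , w∈ = proj₁ (outside v v∉) ; w∈N , w∈C = x∈p∩q⁻ (N v) C w∈ in
    w , x∈p∩q⁺ (x∈p∪q⁺ (inj₁ w∈N) , w∈C)

  totalDominating : ¬ HasIsolatedVertex (induced G C) → TotalDominating G C
  totalDominating ¬iso v with v ∈? C
  ... | no  v∉ = proj₁ (outside v v∉)
  ... | yes v∈ with i , refl ← enum-surjective C v∈ with nonempty? (trace G C (enum C i))
  ... | yes ne = trace-nonempty⁻ G C ne
  ... | no  empty = contradiction (i , empty) ¬iso

  minimum-OD : IsMinimumCode OD G C
  minimum-OD = (separating , dominating) , λ _ (sep , _) → separating-minimum sep

  minimum-OTD : ¬ HasIsolatedVertex (induced G C) → IsMinimumCode OTD G C
  minimum-OTD ¬iso = (separating , totalDominating ¬iso) , λ _ (sep , _) → separating-minimum sep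

  n≢0 : NonZero n
  n≢0 = >-nonZero (≤-trans (s≤s z≤n) (≤-trans 3≤k (subst (_≤ n) card (∣p∣≤n C))))

  density-OD : HasIsolatedVertex (induced G C) → AttainsMinimumDensity OD k G
  density-OD iso = mostVertices⇒minimumDensity OD G n≢0 minimum-OD card
    λ { {m} H (sep , _) cardD →
        ≤-trans (subst (λ d → m ≤ 2 ^ d) cardD (separating⇒n≤2^ H sep)) (2^k≤n iso) }

  -- A competitor on `m` vertices satisfies `m < 2 ^ k ≤ 1 + n`, hence `m ≤ n`.
  density-OTD : ¬ HasIsolatedVertex (induced G C) → AttainsMinimumDensity OTD k G
  density-OTD ¬iso = mostVertices⇒minimumDensity OTD G n≢0 (minimum-OTD ¬iso) card
    λ { {m} H (sep , dom) cardD → s≤s⁻¹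
        (≤-trans (subst (λ d → m < 2 ^ d) cardD (totalDominating⇒n<2^ H sep dom)) 2^k≤1+n) }

-- Existence

-- The missing subsets when `C` is the whole vertex set of the base graph, where traces are
-- neighbourhoods.
MissingIn : Graph k → Subset k → Set
MissingIn B S = Nonempty S × ¬ (∃[ i ] Graph.N B i ≡ S)

missingIn? : (B : Graph k) → Decidable (MissingIn B)
missingIn? B S = nonempty? S ×-dec ¬? (any? (λ i → Graph.N B i ≟ₛ S))

module Attach (B : Graph k) (N-inj : Injective _≡_ _≡_ (Graph.N B)) where
  open Enumeration (enumerate (missingIn? B)) renaming (size to r)

  traceOf : Fin k ⊎ Fin r → Subset k
  traceOf (inj₁ i) = Graph.N B i
  traceOf (inj₂ j) = member j

  -- Adjacency to a base vertex is read off the intended trace, and the second clause mirrors this.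
  -- Attached vertices are made pairwise non-adjacent, one choice among many.
  adjacent : Fin k ⊎ Fin r → Fin k ⊎ Fin r → Bool
  adjacent x        (inj₁ i) = lookup (traceOf x) i
  adjacent (inj₁ i) (inj₂ j) = lookup (member j) i
  adjacent (inj₂ _) (inj₂ _) = false

  adjacent-sym : ∀ x y → adjacent x y ≡ adjacent y x
  adjacent-sym (inj₁ i) (inj₁ j) =
    trans (adj≡lookup B i j) (trans (Graph.adj-sym B i j) (sym (adj≡lookup B j i)))
  adjacent-sym (inj₁ _) (inj₂ _) = refl
  adjacent-sym (inj₂ _) (inj₁ _) = refl
  adjacent-sym (inj₂ _) (inj₂ _) = refl

  adjacent-irrefl : ∀ x → adjacent x x ≡ false
  adjacent-irrefl (inj₁ i) = trans (adj≡lookup B i i) (Graph.adj-irrefl B i)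
  adjacent-irrefl (inj₂ _) = refl

  G : Graph (k + r)
  G = record
    { adj        = λ u v → adjacent (splitAt k u) (splitAt k v)
    ; adj-sym    = λ u v → adjacent-sym (splitAt k u) (splitAt k v)
    ; adj-irrefl = λ v → adjacent-irrefl (splitAt k v)
    }

  open Graph G using (N)

  C : Subset (k + r)
  C = ⊤ {k} ++ ⊥

  -- Every vertex has its intended trace: `⊤` keeps the base coordinates and `⊥` clears the attached
  -- ones, checked coordinatewise through `splitAt`.
  N∩C : ∀ v → N v ∩ C ≡ traceOf (splitAt k v) ++ ⊥
  N∩C v = begin
    N v ∩ C                                        ≡⟨ tabulate∘lookup (N v ∩ C) ⟨
    tabulate (lookup (N v ∩ C))                    ≡⟨ tabulate-cong pointwise ⟩
    tabulate (lookup (traceOf (splitAt k v) ++ ⊥)) ≡⟨ tabulate∘lookup _ ⟩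
    traceOf (splitAt k v) ++ ⊥                     ∎
    where
    open ≡-Reasoning
    cases : ∀ x y → adjacent x y ∧ [ lookup ⊤ , lookup ⊥ ]′ y
                    ≡ [ lookup (traceOf x) , lookup ⊥ ]′ y
    cases x (inj₁ i) rewrite lookup-replicate i true  = ∧-identityʳ _
    cases x (inj₂ j) rewrite lookup-replicate j false = ∧-zeroʳ (adjacent x (inj₂ j))

    pointwise : ∀ w → lookup (N v ∩ C) w ≡ lookup (traceOf (splitAt k v) ++ ⊥) w
    pointwise w = begin
      lookup (N v ∩ C) w
        ≡⟨ lookup-zipWith _∧_ w (N v) C ⟩
      lookup (N v) w ∧ lookup C w
        ≡⟨ cong₂ _∧_ (adj≡lookup G v w) (lookup-splitAt k ⊤ ⊥ w) ⟩
      adjacent (splitAt k v) (splitAt k w) ∧ [ lookup ⊤ , lookup ⊥ ]′ (splitAt k w)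
        ≡⟨ cases (splitAt k v) (splitAt k w) ⟩
      [ lookup (traceOf (splitAt k v)) , lookup ⊥ ]′ (splitAt k w)
        ≡⟨ lookup-splitAt k (traceOf (splitAt k v)) ⊥ w ⟨
      lookup (traceOf (splitAt k v) ++ ⊥) w ∎

  N∩C-↑ˡ : ∀ i → N (i ↑ˡ r) ∩ C ≡ Graph.N B i ++ ⊥
  N∩C-↑ˡ i = trans (N∩C (i ↑ˡ r)) (cong (λ x → traceOf x ++ ⊥) (splitAt-↑ˡ k i r))

  N∩C-↑ʳ : ∀ j → N (k ↑ʳ j) ∩ C ≡ member j ++ ⊥
  N∩C-↑ʳ j = trans (N∩C (k ↑ʳ j)) (cong (λ x → traceOf x ++ ⊥) (splitAt-↑ʳ k r j))

  ↑ˡ∈C : ∀ i → i ↑ˡ r ∈ C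
  ↑ˡ∈C i = ∈-++⁺ˡ ∈⊤

  ∈C⁻ : ∀ {v} → v ∈ C → ∃[ i ] i ↑ˡ r ≡ v
  ∈C⁻ v∈ with ∈-++⊥⁻ (⊤ {k}) v∈
  ... | i , _ , eq = i , eq

  ↑ʳ∉C : ∀ j → k ↑ʳ j ∉ C
  ↑ʳ∉C j j∈ with ∈C⁻ j∈
  ... | i , eq with trans (sym (splitAt-↑ˡ k i r)) (trans (cong (splitAt k) eq) (splitAt-↑ʳ k r j))
  ... | ()

  ∉C⁻ : ∀ {v} → v ∉ C → ∃[ j ] k ↑ʳ j ≡ v
  ∉C⁻ {v} v∉ with splitAt k v | join-splitAt k r v
  ... | inj₁ i | refl = contradiction (↑ˡ∈C i) v∉
  ... | inj₂ j | eq   = j , eq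

  ++⊥-injective : ∀ {S S′ : Subset k} → S ++ ⊥ {r} ≡ S′ ++ ⊥ → S ≡ S′
  ++⊥-injective {S} {S′} = ++-injectiveˡ S S′

  inducedVertex : ∀ i → ∃[ a ] a ↑ˡ r ≡ enum C i
  inducedVertex i = ∈C⁻ (enum-∈ C i)

  -- Twins in `G[C]` would have equal traces on `C`, which are padded neighbourhoods in `B`; `N-inj`
  -- then identifies the two vertices.
  twinFree : ¬ HasOpenTwins (induced G C)
  twinFree (i , j , i≢j , _ , eq) with inducedVertex i | inducedVertex j
  ... | a , a≡ | b , b≡ = i≢j (enum-injective C (begin
    enum C i ≡⟨ a≡ ⟨
    a ↑ˡ r   ≡⟨ cong (_↑ˡ r) (N-inj (++⊥-injective (begin
      Graph.N B a ++ ⊥ ≡⟨ N∩C-↑ˡ a ⟨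
      N (a ↑ˡ r) ∩ C   ≡⟨ cong (λ v → N v ∩ C) a≡ ⟩
      N (enum C i) ∩ C ≡⟨ trace≡⇒N∩≡ G C eq ⟩
      N (enum C j) ∩ C ≡⟨ cong (λ v → N v ∩ C) b≡ ⟨
      N (b ↑ˡ r) ∩ C   ≡⟨ N∩C-↑ˡ b ⟩
      Graph.N B b ++ ⊥ ∎))) ⟩
    b ↑ˡ r   ≡⟨ b≡ ⟩
    enum C j ∎))
    where open ≡-Reasoning

  ++⊥-nonempty⁺ : ∀ {S : Subset k} → Nonempty S → Nonempty (S ++ ⊥ {r})
  ++⊥-nonempty⁺ (i , i∈) = i ↑ˡ r , ∈-++⁺ˡ i∈

  ++⊥-nonempty⁻ : ∀ {S : Subset k} → Nonempty (S ++ ⊥ {r}) → Nonempty S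
  ++⊥-nonempty⁻ {S} (_ , v∈) with ∈-++⊥⁻ S v∈
  ... | i , i∈ , _ = i , i∈

  outside : ∀ {v} → v ∉ C →
    Nonempty (N v ∩ C) × N v ∩ C ⊆ C × ¬ (∃[ u ] u ∈ C × N u ∩ C ≡ N v ∩ C)
  outside v∉ with j , refl ← ∉C⁻ v∉ with sound j
  ... | ne , ∄i =
    subst Nonempty (sym (N∩C-↑ʳ j)) (++⊥-nonempty⁺ ne) , p∩q⊆q (N (k ↑ʳ j)) C , ∄u
    where
    ∄u : ¬ (∃[ u ] u ∈ C × N u ∩ C ≡ N (k ↑ʳ j) ∩ C)
    ∄u (u , u∈ , eq) with i , refl ← ∈C⁻ u∈ =
      ∄i (i , ++⊥-injective (trans (sym (N∩C-↑ˡ i)) (trans eq (N∩C-↑ʳ j))))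

  -- Soundness of the enumeration yields `outside`; completeness and injectivity yield existence and
  -- uniqueness in `missing`.
  isGO : IsGO k G C
  isGO = record
    { card     = ∣⊤++⊥∣≡ k r
    ; no-twins = twinFree
    ; outside  = λ _ → outside
    ; missing  = missing
    }
    where
    missing : ∀ C′ → Nonempty C′ × C′ ⊆ C × ¬ (∃[ u ] u ∈ C × N u ∩ C ≡ C′) →
      ∃[ v ] (v ∉ C × N v ∩ C ≡ C′) × (∀ {w} → w ∉ C × N w ∩ C ≡ C′ → v ≡ w)
    missing C′ (ne , C′⊆ , ∄u) with S , refl ← ⊆⊤++⊥⁻ k C′ C′⊆
      with complete (++⊥-nonempty⁻ ne ,
                     λ (i , eq) → ∄u (i ↑ˡ r , ↑ˡ∈C i , trans (N∩C-↑ˡ i) (cong (_++ ⊥) eq)))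
    ... | j , refl = k ↑ʳ j , (↑ʳ∉C j , N∩C-↑ʳ j) , unique
      where
      unique : ∀ {w} → w ∉ C × N w ∩ C ≡ member j ++ ⊥ → k ↑ʳ j ≡ w
      unique (w∉ , eq) with l , refl ← ∉C⁻ w∉ =
        cong (k ↑ʳ_) (injective (++⊥-injective (trans (sym eq) (N∩C-↑ʳ l))))

  -- `induced G C` has its vertices in `Fin ∣ C ∣` rather than `Fin k`, so the vertices of the two
  -- graphs are matched through their common image in `G`.
  isolated⁻ : HasIsolatedVertex (induced G C) → HasIsolatedVertex B
  isolated⁻ (i , empty) with inducedVertex i
  ... | a , a≡ = a , λ ne → empty (trace-nonempty⁺ G C
    (subst (λ v → Nonempty (N v ∩ C)) a≡ (subst Nonempty (sym (N∩C-↑ˡ a)) (++⊥-nonempty⁺ ne))))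

  isolated⁺ : HasIsolatedVertex B → HasIsolatedVertex (induced G C)
  isolated⁺ (a , empty) with enum-surjective C (↑ˡ∈C a)
  ... | i , a≡ = i , λ ne → empty (++⊥-nonempty⁻ (subst Nonempty (N∩C-↑ˡ a)
    (subst (λ v → Nonempty (N v ∩ C)) a≡ (trace-nonempty⁻ G C ne))))

-- Base graphs with and without an isolated vertex

complete : ∀ k → Graph k
complete k = record
  { adj        = λ i j → not (does (i ≟ j))
  ; adj-sym    = symmetric
  ; adj-irrefl = λ i → cong not (dec-true (i ≟ i) refl)
  }
  where
  symmetric : ∀ i j → not (does (i ≟ j)) ≡ not (does (j ≟ i))
  symmetric i j with i ≟ j | j ≟ i
  ... | yes _   | yes _   = refl
  ... | no  _   | no  _   = refl
  ... | yes i≡j | no  j≢i = contradiction (sym i≡j) j≢i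
  ... | no  i≢j | yes j≡i = contradiction (sym j≡i) i≢j

-- If `N i = N j`, then `i` is absent from `N j`, and `j` is the only vertex absent from it.
complete-N-injective : ∀ k → Injective _≡_ _≡_ (Graph.N (complete k))
complete-N-injective k {i} {j} eq with j ≟ i | (begin
    not (does (j ≟ i))  ≡⟨ adj≡lookup (complete k) j i ⟨
    lookup (N j) i      ≡⟨ cong (λ S → lookup S i) eq ⟨
    lookup (N i) i      ≡⟨ adj≡lookup (complete k) i i ⟩
    not (does (i ≟ i))  ≡⟨ adj-irrefl i ⟩
    false               ∎)
  where open ≡-Reasoning
        open Graph (complete k)
... | yes j≡i | _ = sym j≡i

complete-noIsolated : ¬ HasIsolatedVertex (complete (2 + k))
complete-noIsolated (zero  , empty) = empty (suc zero , there here)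
complete-noIsolated (suc _ , empty) = empty (zero , here)

addIsolated : Graph k → Graph (suc k)
addIsolated {k} B = record { adj = adj′ ; adj-sym = symmetric ; adj-irrefl = irreflexive }
  where
  open Graph B
  adj′ : Fin (suc k) → Fin (suc k) → Bool
  adj′ zero    _       = false
  adj′ (suc _) zero    = false
  adj′ (suc i) (suc j) = adj i j

  symmetric : ∀ i j → adj′ i j ≡ adj′ j i
  symmetric zero    zero    = refl
  symmetric zero    (suc _) = refl
  symmetric (suc _) zero    = refl
  symmetric (suc i) (suc j) = adj-sym i j

  irreflexive : ∀ i → adj′ i i ≡ false
  irreflexive zero    = refl
  irreflexive (suc i) = adj-irrefl i

addIsolated-isolated : (B : Graph k) → Isolated (addIsolated B) zero
addIsolated-isolated B (j , j∈)
  with () ← trans (sym ([]=⇒lookup j∈)) (adj≡lookup (addIsolated B) zero j)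

-- The new vertex has empty neighbourhood, which no vertex of `B` shares.
addIsolated-N-injective : (B : Graph k) → ¬ HasIsolatedVertex B →
  Injective _≡_ _≡_ (Graph.N B) → Injective _≡_ _≡_ (Graph.N (addIsolated B))
addIsolated-N-injective {k} B ¬iso N-inj = inj
  where
  open Graph (addIsolated B) using (N)
  N-zero≢N-suc : ∀ i → N zero ≢ N (suc i)
  N-zero≢N-suc i eq = ¬iso (i , λ (j , j∈) →
    addIsolated-isolated B (suc j , subst (suc j ∈_) (sym eq) (there j∈)))

  inj : Injective _≡_ _≡_ N
  inj {zero}  {zero}  _  = refl
  inj {zero}  {suc j} eq = contradiction eq (N-zero≢N-suc j)
  inj {suc i} {zero}  eq = contradiction (sym eq) (N-zero≢N-suc i)
  inj {suc i} {suc j} eq = cong suc (N-inj (cong (proj₂ ∘ uncons) eq))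

-- The base is a complete graph on `k` minus 1 vertices with an isolated vertex added. Together with
-- `existsGO-noIsolated` this shows that both density claims speak of actual graphs.
existsGO-isolated : 3 ≤ k →
  ∃[ n ] Σ[ G ∈ Graph n ] ∃[ C ] IsGO k G C × HasIsolatedVertex (induced G C)
existsGO-isolated {k = suc (suc (suc k))} _ =
  _ , G , C , isGO , isolated⁺ (zero , addIsolated-isolated (complete (2 + k)))
  where
  open Attach (addIsolated (complete (2 + k)))
    (addIsolated-N-injective (complete (2 + k)) complete-noIsolated (complete-N-injective (2 + k)))
existsGO-isolated {k = suc zero}       (s≤s ())
existsGO-isolated {k = suc (suc zero)} (s≤s (s≤s ()))

existsGO-noIsolated : 3 ≤ k →
  ∃[ n ] Σ[ G ∈ Graph n ] ∃[ C ] IsGO k G C × ¬ HasIsolatedVertex (induced G C)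
existsGO-noIsolated {k = suc (suc k)} _ = _ , G , C , isGO , complete-noIsolated ∘ isolated⁻
  where open Attach (complete (2 + k)) (complete-N-injective (2 + k))
existsGO-noIsolated {k = suc zero} (s≤s ())

theorem3 : (k : ℕ) → 3 ≤ k →
    (∀ {n} (G : Graph n) (C : Subset n) → IsGO k G C →
    IsMinimumCode OD G C
    × (¬ HasIsolatedVertex (induced G C) → IsMinimumCode OTD G C)
    × ((¬ HasIsolatedVertex (induced G C)) ⇔ Admissible OTD (induced G C))
    × (HasIsolatedVertex (induced G C) → AttainsMinimumDensity OD k G)
    × (¬ HasIsolatedVertex (induced G C) → AttainsMinimumDensity OTD k G))
    × (∃[ n ] Σ[ G ∈ Graph n ] ∃[ C ] IsGO k G C × HasIsolatedVertex (induced G C))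
    × (∃[ n ] Σ[ G ∈ Graph n ] ∃[ C ] IsGO k G C × ¬ HasIsolatedVertex (induced G C))
theorem3 k 3≤k =
    (λ G C go → let open Codes 3≤k go in
        minimum-OD , minimum-OTD , otd-admissible (induced G C) (IsGO.no-twins go)
      , density-OD , density-OTD)
  , existsGO-isolated 3≤k
  , existsGO-noIsolated 3≤k
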